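{- Let $A$ be a finite skew brace with $(A,+)$ abelian such that $\Theta(A)$ has exactly one vertex. Then $A$ is isomorphic to one of: (1) $\mathbb{Z}/4\mathbb{Z}$ with its usual addition and $x\circ y=x+y+2xy$; (2) $\mathbb{Z}/2\mathbb{Z}\times\mathbb{Z}/2\mathbb{Z}$ with componentwise addition and $(x_1,y_1)\circ(x_2,y_2)=(x_1+x_2+y_1y_2,\,y_1+y_2)$; (3) $\mathbb{Z}/2\mathbb{Z}\times\mathbb{Z}/4\mathbb{Z}$ with componentwise addition and $(x_1,y_1)\circ(x_2,y_2)=\big(x_1+x_2+\varepsilon(y_1)y_2,\,y_1+y_2+2y_1y_2\big)$, where $\varepsilon(y_1)=0$ if $y_1\in\{0,1\}$ and $\varepsilon(y_1)=1$ if $y_1\in\{2,3\}$, and $\varepsilon(y_1)y_2$ is computed in $\mathbb{Z}/2\mathbb{Z}$.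
   Context: A skew brace is a triple $(A,+,\circ)$ where $(A,+)$ and $(A,\circ)$ are groups with $a\circ(b+c)=a\circ b-a+a\circ c$. $\lambda_a(b)=-a+a\circ b$; $\theta_{(a,b)}(c)=a+\lambda_b(c)-a$ defines an action of $(A,+)\rtimes_\lambda(A,\circ)$ on $(A,+)$ by automorphisms. $\Theta(A)$ is the graph whose vertices are the $\theta$-orbits of size $>1$, two distinct vertices $L_1,L_2$ adjacent iff $\gcd(|L_1|,|L_2|)\ne1$. -}

module Defs where

open import Level using (Level; _⊔_; 0ℓ) renaming (suc to lsuc)
open import Algebra.Bundles using (Group; RawGroup)
open import Algebra.Core using (Op₁; Op₂)
open import Algebra.Definitions using (Commutative)
open import Algebra.Structures using (IsGroup)
open import Algebra.Morphism.Structures using (module GroupMorphisms)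
open import Data.Fin.Base using (Fin; toℕ)
open import Data.Fin.Patterns using (0F; 1F; 2F; 3F)
import Data.Fin.Properties as Fin
open import Data.Fin.Subset using (Subset; _∈_; ∣_∣)
open import Data.Nat.Base as ℕ using (ℕ; NonZero; _∸_)
open import Data.Nat.DivMod using (_mod_)
open import Data.Nat.GCD using (gcd; gcd-comm)
open import Data.Product.Base using (Σ; ∃; _×_; _,_; proj₁)
open import Data.Product.Properties using (≡-dec)
open import Function.Bundles using (Inverse; _⇔_)
open import Relation.Binary.Bundles using (Setoid)
open import Relation.Binary.Core using (Rel)
open import Relation.Binary.Definitions
  using (DecidableEquality; Symmetric; Irreflexive; _Respects₂_)
import Relation.Binary.Construct.On as On
open import Relation.Binary.PropositionalEquality
  using (_≡_; _≢_; refl; sym; trans; cong; cong₂; isEquivalence)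
import Relation.Binary.PropositionalEquality as ≡
open import Relation.Nullary.Decidable using (Dec; map′; _×-dec_; from-yes)
open import Relation.Unary using (Pred; Decidable)

private
  variable
    c c′ ℓ ℓ′ : Level

record SkewBrace (c ℓ : Level) : Set (lsuc (c ⊔ ℓ)) where
  infix  8 _⁻¹
  infix  8 -_
  infixl 7 _∘_
  infixl 6 _+_ _-_
  infix  4 _≈_
  field
    Carrier   : Set c
    _≈_       : Rel Carrier ℓ
    _+_       : Op₂ Carrier
    0#        : Carrier
    -_        : Op₁ Carrier
    _∘_       : Op₂ Carrier
    e         : Carrier
    _⁻¹       : Op₁ Carrier
    +-isGroup : IsGroup _≈_ _+_ 0# -_
    ∘-isGroup : IsGroup _≈_ _∘_ e _⁻¹

  _-_ : Op₂ Carrier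
  a - b = a + (- b)

  field
    ∘-skewDistrib : ∀ a x y → a ∘ (x + y) ≈ a ∘ x - a + a ∘ y

  +-group : Group c ℓ
  +-group = record { isGroup = +-isGroup }

  ∘-group : Group c ℓ
  ∘-group = record { isGroup = ∘-isGroup }

  setoid : Setoid c ℓ
  setoid = Group.setoid +-group

  λ-map : Carrier → Carrier → Carrier
  λ-map a x = - a + a ∘ x

  θ : Carrier × Carrier → Carrier → Carrier
  θ (a , b) x = a + λ-map b x - a

  -- y lies in the θ-orbit of x; as (a , b) ranges over all of A × A, this is
  -- the orbit under the semidirect product (A,+) ⋊ (A,∘).
  InOrbit : Carrier → Carrier → Set (c ⊔ ℓ)
  InOrbit x y = ∃ λ (g : Carrier × Carrier) → θ g x ≈ y

AdditivelyAbelian : SkewBrace c ℓ → Set (c ⊔ ℓ)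
AdditivelyAbelian A = Commutative _≈_ _+_
  where open SkewBrace A

record Finite (A : SkewBrace c ℓ) : Set (c ⊔ ℓ) where
  field
    order       : ℕ
    enumeration : Inverse (SkewBrace.setoid A) (≡.setoid (Fin order))

  element : Fin order → SkewBrace.Carrier A
  element = Inverse.from enumeration

infix 4 _≅_

_≅_ : SkewBrace c ℓ → SkewBrace c′ ℓ′ → Set (c ⊔ ℓ ⊔ c′ ⊔ ℓ′)
A ≅ B = ∃ λ (f : A.Carrier → B.Carrier)
    → GroupMorphisms.IsGroupIsomorphism (raw A.+-group) (raw B.+-group) f
    × GroupMorphisms.IsGroupIsomorphism (raw A.∘-group) (raw B.∘-group) f
  where
  module A = SkewBrace A
  module B = SkewBrace B
  raw : ∀ {a b} → Group a b → RawGroup a b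
  raw = Group.rawGroup

record SimpleGraph (v e a : Level) : Set (lsuc (v ⊔ e ⊔ a)) where
  field
    vertices : Setoid v e

  open Setoid vertices public using () renaming (Carrier to Vertex; _≈_ to _≈ᵥ_)

  field
    Adjacent : Rel Vertex a
    resp     : Adjacent Respects₂ _≈ᵥ_
    irrefl   : Irreflexive _≈ᵥ_ Adjacent
    symm     : Symmetric Adjacent

HasExactlyOneVertex : ∀ {v e a} → SimpleGraph v e a → Set (v ⊔ e)
HasExactlyOneVertex G = ∃ λ (v : Vertex) → ∀ w → v ≈ᵥ w
  where open SimpleGraph G

module _ (A : SkewBrace c ℓ) (fin : Finite A) where
  open SkewBrace A using (Carrier; InOrbit)
  open Finite fin using (order; element)

  -- Subsets of A are given by their sets of indices in the enumeration of A,
  -- so that equality of orbits is _≡_ and the size of an orbit is ∣_∣.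
  IsOrbit : Subset order → Set (c ⊔ ℓ)
  IsOrbit L = ∃ λ (x : Carrier) → ∀ i → i ∈ L ⇔ InOrbit x (element i)

  ΘVertex : Set (c ⊔ ℓ)
  ΘVertex = Σ (Subset order) λ L → IsOrbit L × 1 ℕ.< ∣ L ∣

  Θ : SimpleGraph (c ⊔ ℓ) 0ℓ 0ℓ
  Θ = record
    { vertices = On.setoid {B = ΘVertex} (≡.setoid (Subset order)) proj₁
    ; Adjacent = λ (L₁ , _) (L₂ , _) → L₁ ≢ L₂ × gcd ∣ L₁ ∣ ∣ L₂ ∣ ≢ 1
    ; resp     = (λ { refl adj → adj }) , (λ { refl adj → adj })
    ; irrefl   = λ L₁≡L₂ (L₁≢L₂ , _) → L₁≢L₂ L₁≡L₂
    ; symm     = λ {(L₁ , _)} {(L₂ , _)} (L₁≢L₂ , gcd≢1) →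
        (λ eq → L₁≢L₂ (sym eq)) ,
        (λ eq → gcd≢1 (trans (gcd-comm ∣ L₁ ∣ ∣ L₂ ∣) eq))
    }

ℤ/ : ℕ → Set
ℤ/ n = Fin n

module Mod {n : ℕ} .{{_ : NonZero n}} where
  infix  8 -ₘ_
  infixl 7 _*ₘ_
  infixl 6 _+ₘ_

  _+ₘ_ : Op₂ (ℤ/ n)
  x +ₘ y = (toℕ x ℕ.+ toℕ y) mod n

  _*ₘ_ : Op₂ (ℤ/ n)
  x *ₘ y = (toℕ x ℕ.* toℕ y) mod n

  -ₘ_ : Op₁ (ℤ/ n)
  -ₘ x = (n ∸ toℕ x) mod n

open Mod public

private
  module Decide {X : Set} (_≟_ : DecidableEquality X)
    (∀? : ∀ {P : Pred X 0ℓ} → Decidable P → Dec (∀ x → P x)) where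

    isGroup? : ∀ _∙_ ε inv → Dec (IsGroup (_≡_ {A = X}) _∙_ ε inv)
    isGroup? _∙_ ε inv = map′ to from
      ( (∀? λ x → ∀? λ y → ∀? λ z → ((x ∙ y) ∙ z) ≟ (x ∙ (y ∙ z)))
      ×-dec ((∀? λ x → (ε ∙ x) ≟ x) ×-dec (∀? λ x → (x ∙ ε) ≟ x))
      ×-dec ((∀? λ x → (inv x ∙ x) ≟ ε) ×-dec (∀? λ x → (x ∙ inv x) ≟ ε)))
      where
      to = λ (assoc , identity , inverse) → record
        { isMonoid = record
          { isSemigroup = record
            { isMagma = record
              { isEquivalence = isEquivalence ; ∙-cong = cong₂ _∙_ }
            ; assoc = assoc
            }
          ; identity = identity
          }
        ; inverse = inverse
        ; ⁻¹-cong = cong inv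
        }
      from = λ (G : IsGroup _≡_ _∙_ ε inv) →
        IsGroup.assoc G , IsGroup.identity G , IsGroup.inverse G

    skewDistrib? : ∀ (_+_ : Op₂ X) (-_ : Op₁ X) (_∘_ : Op₂ X) →
      Dec (∀ a x y → a ∘ (x + y) ≡ ((a ∘ x) + (- a)) + (a ∘ y))
    skewDistrib? _+_ -_ _∘_ = ∀? λ a → ∀? λ x → ∀? λ y →
      (a ∘ (x + y)) ≟ (((a ∘ x) + (- a)) + (a ∘ y))

  allPairs? : ∀ {m n} {P : Pred (Fin m × Fin n) 0ℓ} →
    Decidable P → Dec (∀ x → P x)
  allPairs? P? = map′ (λ f (i , j) → f i j) (λ f i j → f (i , j))
    (Fin.all? λ i → Fin.all? λ j → P? (i , j))

  module Decide₁ {n : ℕ} = Decide (Fin._≟_ {n}) Fin.all?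
  module Decide₂ {m n : ℕ} = Decide (≡-dec (Fin._≟_ {m}) (Fin._≟_ {n})) allPairs?

module B₁ where
  infixl 7 _∘_
  infixl 6 _+_

  _+_ : Op₂ (ℤ/ 4)
  x + y = x +ₘ y

  -_ : Op₁ (ℤ/ 4)
  - x = -ₘ x

  _∘_ : Op₂ (ℤ/ 4)
  x ∘ y = x +ₘ y +ₘ 2F *ₘ x *ₘ y

B₁ : SkewBrace 0ℓ 0ℓ
B₁ = record
  { Carrier       = ℤ/ 4
  ; _≈_           = _≡_
  ; _+_           = B₁._+_
  ; 0#            = 0F
  ; -_            = B₁.-_
  ; _∘_           = B₁._∘_
  ; e             = 0F
  ; _⁻¹           = λ x → x
  ; +-isGroup     = from-yes (Decide₁.isGroup? B₁._+_ 0F B₁.-_)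
  ; ∘-isGroup     = from-yes (Decide₁.isGroup? B₁._∘_ 0F (λ x → x))
  ; ∘-skewDistrib = from-yes (Decide₁.skewDistrib? B₁._+_ B₁.-_ B₁._∘_)
  }

module B₂ where
  infixl 7 _∘_
  infixl 6 _+_

  _+_ : Op₂ (ℤ/ 2 × ℤ/ 2)
  (x₁ , y₁) + (x₂ , y₂) = x₁ +ₘ x₂ , y₁ +ₘ y₂

  -_ : Op₁ (ℤ/ 2 × ℤ/ 2)
  - (x , y) = -ₘ x , -ₘ y

  _∘_ : Op₂ (ℤ/ 2 × ℤ/ 2)
  (x₁ , y₁) ∘ (x₂ , y₂) = x₁ +ₘ x₂ +ₘ y₁ *ₘ y₂ , y₁ +ₘ y₂

  _⁻¹ : Op₁ (ℤ/ 2 × ℤ/ 2)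
  (x , y) ⁻¹ = x +ₘ y , y

B₂ : SkewBrace 0ℓ 0ℓ
B₂ = record
  { Carrier       = ℤ/ 2 × ℤ/ 2
  ; _≈_           = _≡_
  ; _+_           = B₂._+_
  ; 0#            = 0F , 0F
  ; -_            = B₂.-_
  ; _∘_           = B₂._∘_
  ; e             = 0F , 0F
  ; _⁻¹           = B₂._⁻¹
  ; +-isGroup     = from-yes (Decide₂.isGroup? B₂._+_ (0F , 0F) B₂.-_)
  ; ∘-isGroup     = from-yes (Decide₂.isGroup? B₂._∘_ (0F , 0F) B₂._⁻¹)
  ; ∘-skewDistrib = from-yes (Decide₂.skewDistrib? B₂._+_ B₂.-_ B₂._∘_)
  }

module B₃ where
  infixl 7 _∘_
  infixl 6 _+_

  ε : ℤ/ 4 → ℤ/ 2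
  ε 0F = 0F
  ε 1F = 0F
  ε 2F = 1F
  ε 3F = 1F

  mod2 : ℤ/ 4 → ℤ/ 2
  mod2 y = toℕ y mod 2

  _+_ : Op₂ (ℤ/ 2 × ℤ/ 4)
  (x₁ , y₁) + (x₂ , y₂) = x₁ +ₘ x₂ , y₁ +ₘ y₂

  -_ : Op₁ (ℤ/ 2 × ℤ/ 4)
  - (x , y) = -ₘ x , -ₘ y

  _∘_ : Op₂ (ℤ/ 2 × ℤ/ 4)
  (x₁ , y₁) ∘ (x₂ , y₂) =
    x₁ +ₘ x₂ +ₘ ε y₁ *ₘ mod2 y₂ , y₁ +ₘ y₂ +ₘ 2F *ₘ y₁ *ₘ y₂

  _⁻¹ : Op₁ (ℤ/ 2 × ℤ/ 4)
  (x , y) ⁻¹ = x +ₘ ε y *ₘ mod2 y , y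

B₃ : SkewBrace 0ℓ 0ℓ
B₃ = record
  { Carrier       = ℤ/ 2 × ℤ/ 4
  ; _≈_           = _≡_
  ; _+_           = B₃._+_
  ; 0#            = 0F , 0F
  ; -_            = B₃.-_
  ; _∘_           = B₃._∘_
  ; e             = 0F , 0F
  ; _⁻¹           = B₃._⁻¹
  ; +-isGroup     = from-yes (Decide₂.isGroup? B₃._+_ (0F , 0F) B₃.-_)
  ; ∘-isGroup     = from-yes (Decide₂.isGroup? B₃._∘_ (0F , 0F) B₃._⁻¹)
  ; ∘-skewDistrib = from-yes (Decide₂.skewDistrib? B₃._+_ B₃.-_ B₃._∘_)
  }

{-# OPTIONS --safe #-}

-- As (A,+) is abelian, θ-orbits are λ-orbits.  Let F be the subgroup of λ-fixed points
-- and x ∉ F; the hypothesis says that A ∖ F is the orbit of x.  The stabiliser of x is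
-- nontrivial since 0 is not in the orbit, so the orbit fills at most half of A; as it
-- contains x + F, we get A ∖ F = x + F and a stabiliser {0, s} of order two.
-- Put δ a = λ_a(x) − x.  This is a homomorphism from (A,∘) onto (F,+) with kernel {0, s},
-- and a ∘ b is a + b for b ∈ F and a + b + δ a for b ∉ F.  Additivity of λ_a gives
-- 2F = 0, and computing δ(a ∘ x) in two ways gives δ(δ a) = 0 for a ∈ F and
-- δ(2x) + δ(δ x) = 0.  Hence s ∈ F, and with q = δ x there are two possibilities:
-- if δ q = 0, then F = {0, s} and 2x is 0 (giving B₂) or s (giving B₁); if δ q = s, then
-- F = {0, s, q, s + q} and, after possibly replacing x by x + q, 2x = q (giving B₃).

module Submission where

open import Defs
open import Level using (Level)
open import Data.Sum.Base using (_⊎_; inj₁; inj₂; [_,_]′)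

open import Algebra.Bundles using (AbelianGroup; Group)
open import Algebra.Morphism.Structures using (module GroupMorphisms)
import Algebra.Properties.AbelianGroup as AbelianGroupProperties
import Algebra.Properties.CommutativeMonoid.Mult as CommutativeMonoidMult
import Algebra.Properties.Group as GroupProperties
import Algebra.Solver.CommutativeMonoid as CommutativeMonoidSolver
open import Data.Fin.Base using (Fin; punchOut; toℕ)
open import Data.Fin.Patterns using (0F; 1F; 2F; 3F)
import Data.Fin.Properties as Fin
open import Data.Fin.Subset using (Subset; _∈_; ⁅_⁆; ∣_∣)
open import Data.Fin.Subset.Properties
  using (x∈⁅x⁆; x∈⁅y⁆⇒x≡y; ∣⁅x⁆∣≡1; p⊆q⇒∣p∣≤∣q∣; p⊂q⇒∣p∣<∣q∣)
open import Data.Nat.Base as ℕ using (ℕ; zero; suc)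
open import Data.Nat.DivMod using (_mod_; _/_; _%_; m%n<n; m≡m%n+[m/n]*n)
import Data.Nat.Properties as ℕ
open import Data.Product.Base using (∃; _×_; _,_; proj₁; proj₂)
open import Data.Vec.Base using (tabulate)
open import Data.Vec.Properties using (lookup∘tabulate; []=⇒lookup; lookup⇒[]=)
open import Function.Base using (_$_; case_of_)
open import Function.Bundles using (Inverse; Equivalence; mk⇔; _⇔_)
open import Function.Definitions using (Congruent; Injective; Surjective)
open import Relation.Binary.PropositionalEquality as ≡ using (_≡_; _≢_)
import Relation.Binary.Reasoning.Setoid as SetoidReasoning
open import Relation.Nullary.Decidable
  using (Dec; yes; no; does; map′; ¬?; _×-dec_; dec-true; decidable-stable)
open import Relation.Nullary.Negation using (¬_; contradiction)
open import Relation.Unary using (Pred; Decidable)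

private
  variable
    c c′ ℓ ℓ′ p : Level
    n : ℕ

-- Finite sets: injective self-maps and decidable subsets.

injective⇒surjective : ∀ {f : Fin n → Fin n} → Injective _≡_ _≡_ f → ∀ j → ∃ λ i → f i ≡ j
injective⇒surjective {suc n} {f} inj j = decidable-stable (Fin.any? λ i → f i Fin.≟ j) λ ∄ →
  let j≢f : ∀ i → j ≢ f i
      j≢f i j≡fi = ∄ (i , ≡.sym j≡fi)
  -- If `j` were missed, punching it out of the codomain would embed `Fin (suc n)` in `Fin n`.
  in ℕ.1+n≰n $ Fin.injective⇒≤ {f = λ i → punchOut (j≢f i)}
       λ {i} {k} eq → inj (Fin.punchOut-injective (j≢f i) (j≢f k) eq)

module _ {P : Pred (Fin n) p} (P? : Decidable P) where

  ⟦_⟧ : Subset n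
  ⟦_⟧ = tabulate λ i → does (P? i)

  ∈⟦⟧⇔ : ∀ i → i ∈ ⟦_⟧ ⇔ P i
  ∈⟦⟧⇔ i = mk⇔ to from
    where
    to : i ∈ ⟦_⟧ → P i
    to i∈ with P? i | ≡.trans (≡.sym (lookup∘tabulate (λ k → does (P? k)) i)) ([]=⇒lookup i∈)
    ... | yes pi | _ = pi
    ... | no _   | ()
    from : P i → i ∈ ⟦_⟧
    from pi = lookup⇒[]= i ⟦_⟧
      (≡.trans (lookup∘tabulate (λ k → does (P? k)) i) (dec-true (P? i) pi))

∈∧∈∧≢⇒1<∣∣ : ∀ {L : Subset n} {i j} → i ∈ L → j ∈ L → j ≢ i → 1 ℕ.< ∣ L ∣
∈∧∈∧≢⇒1<∣∣ {L = L} {i} {j} i∈L j∈L j≢i = ≡.subst (ℕ._< ∣ L ∣) (∣⁅x⁆∣≡1 i)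
  (p⊂q⇒∣p∣<∣q∣
    ( (λ k∈ → ≡.subst (_∈ L) (≡.sym (x∈⁅y⁆⇒x≡y i k∈)) i∈L)
    , j , j∈L , λ j∈ → j≢i (x∈⁅y⁆⇒x≡y i j∈)))

-- Isomorphisms of groups and of skew braces.

module _ (G : Group c ℓ) (H : Group c′ ℓ′) where
  private
    module G = Group G
    module H = Group H

  open GroupMorphisms G.rawGroup H.rawGroup

  homo⇒isGroupIsomorphism : ∀ {f} → Congruent G._≈_ H._≈_ f →
    Injective G._≈_ H._≈_ f → Surjective G._≈_ H._≈_ f →
    (∀ x y → f (x G.∙ y) H.≈ f x H.∙ f y) → IsGroupIsomorphism f
  homo⇒isGroupIsomorphism {f} cong inj surj homo = record
    { isGroupMonomorphism = record
      { isGroupHomomorphism = record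
        { isMonoidHomomorphism = record
          { isMagmaHomomorphism = record
            { isRelHomomorphism = record { cong = cong }
            ; homo = homo
            }
          ; ε-homo = ε-homo
          }
        ; ⁻¹-homo = λ x → GroupProperties.inverseˡ-unique H _ _
            (H.trans (H.sym (homo _ x)) (H.trans (cong (G.inverseˡ x)) ε-homo))
        }
      ; injective = inj
      }
    ; surjective = surj
    }
    where
    ε-homo : f G.ε H.≈ H.ε
    ε-homo = GroupProperties.identityʳ-unique H (f G.ε) _
      (H.trans (H.sym (homo _ _)) (cong (G.identityˡ G.ε)))

-- The map goes from B to A because the elements of B can be enumerated; a bijection A → B
-- given by cases on A would need these cases to respect _≈_.
≅-fromHom : ∀ (A : SkewBrace c ℓ) (B : SkewBrace c′ ℓ′) (let module A = SkewBrace A; module B = SkewBrace B)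
  (g : B.Carrier → A.Carrier) →
  (∀ {i j} → i B.≈ j → g i A.≈ g j) →
  (∀ i j → g (i B.+ j) A.≈ g i A.+ g j) →
  (∀ i j → g (i B.∘ j) A.≈ g i A.∘ g j) →
  (∀ i → g i A.≈ A.0# → i B.≈ B.0#) →
  (∀ y → ∃ λ i → g i A.≈ y) →
  A ≅ B
≅-fromHom A B g g-cong g-+ g-∘ g-kernel g-surjective =
  f , homo⇒isGroupIsomorphism A.+-group B.+-group f-cong f-injective f-surjective
        (λ x y → g-injective (trans (gf _) (trans (A+.∙-cong (sym (gf x)) (sym (gf y))) (sym (g-+ _ _)))))
    , homo⇒isGroupIsomorphism A.∘-group B.∘-group f-cong f-injective f-surjective
        (λ x y → g-injective (trans (gf _) (trans (A∘.∙-cong (sym (gf x)) (sym (gf y))) (sym (g-∘ _ _)))))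
  where
  module A = SkewBrace A
  module B = SkewBrace B
  module A+ = Group A.+-group
  module A∘ = Group A.∘-group
  open A+ using (sym; trans)
  open SetoidReasoning A.setoid

  f : A.Carrier → B.Carrier
  f y = proj₁ (g-surjective y)

  gf : ∀ y → g (f y) A.≈ y
  gf y = proj₂ (g-surjective y)

  -- A trivial additive kernel suffices, applied to `i - j`; the same bijection then serves both
  -- group structures.
  g-injective : ∀ {i j} → g i A.≈ g j → i B.≈ j
  g-injective {i} {j} eq = GroupProperties.x∙y⁻¹≈ε⇒x≈y B.+-group i j $ g-kernel _ $
    GroupProperties.∙-cancelʳ A.+-group (g j) _ _ $ begin
      g (i B.- j) A.+ g j   ≈⟨ g-+ (i B.- j) j ⟨
      g (i B.- j B.+ j)     ≈⟨ g-cong (GroupProperties.//-rightDividesˡ B.+-group j i) ⟩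
      g i                   ≈⟨ eq ⟩
      g j                   ≈⟨ A+.identityˡ (g j) ⟨
      A.0# A.+ g j          ∎

  f-cong : ∀ {x y} → x A.≈ y → f x B.≈ f y
  f-cong x≈y = g-injective (trans (gf _) (trans x≈y (sym (gf _))))

  f-injective : ∀ {x y} → f x B.≈ f y → x A.≈ y
  f-injective eq = trans (sym (gf _)) (trans (g-cong eq) (gf _))

  f-surjective : ∀ i → ∃ λ y → ∀ {z} → z A.≈ y → f z B.≈ i
  f-surjective i = g i , λ z≈gi → g-injective (trans (gf _) z≈gi)

-- Additively abelian skew braces: the maps `λ-map a` and their fixed points.

module Brace (A : SkewBrace c ℓ) (+-comm : AdditivelyAbelian A) where
  open SkewBrace A public

  +-abelianGroup : AbelianGroup c ℓ
  +-abelianGroup = record { isAbelianGroup = record { isGroup = +-isGroup ; comm = +-comm } }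

  open AbelianGroup +-abelianGroup public using (refl; reflexive; sym; trans; commutativeMonoid)
    renaming ( ∙-cong to +-cong; ∙-congˡ to +-congˡ; ∙-congʳ to +-congʳ; assoc to +-assoc
             ; identityˡ to +-identityˡ; identityʳ to +-identityʳ
             ; inverseˡ to -‿inverseˡ; inverseʳ to -‿inverseʳ; ⁻¹-cong to -‿cong)
  open Group ∘-group public using ()
    renaming ( ∙-cong to ∘-cong; ∙-congˡ to ∘-congˡ; ∙-congʳ to ∘-congʳ; assoc to ∘-assoc
             ; identityˡ to ∘-identityˡ; identityʳ to ∘-identityʳ
             ; inverseˡ to ⁻¹-inverseˡ)
  module + = AbelianGroupProperties +-abelianGroup
  module ∘ = GroupProperties ∘-group
  open CommutativeMonoidMult commutativeMonoid public
    using (×-distrib-+; ×-homo-+; ×-homo-1; ×-assocˡ; ×-congʳ; ×-congˡ) renaming (_×_ to infixr 8 _·_)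
  open CommutativeMonoidSolver commutativeMonoid public using (solve; _⊜_; _⊕_)
  open SetoidReasoning setoid public

  y+[z-y]≈z : ∀ y z → y + (z - y) ≈ z
  y+[z-y]≈z y z = trans (sym (+-assoc y z (- y))) (+.xyx⁻¹≈y y z)

  ·-zeroʳ : ∀ k → k · 0# ≈ 0#
  ·-zeroʳ zero    = refl
  ·-zeroʳ (suc k) = trans (+-identityˡ _) (·-zeroʳ k)

  -- Division with remainder: `k` exceeds `k % n` by a multiple of `n`, which annihilates `z`.
  mod-· : ∀ {z} n .{{_ : ℕ.NonZero n}} → n · z ≈ 0# → ∀ k → toℕ (k mod n) · z ≈ k · z
  mod-· {z} n nz≈0 k = begin
    toℕ (k mod n) · z                  ≈⟨ ×-congˡ (Fin.toℕ-fromℕ< (m%n<n k n)) ⟩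
    (k % n) · z                        ≈⟨ +-identityʳ _ ⟨
    (k % n) · z + 0#                   ≈⟨ +-congˡ (trans (×-congʳ (k / n) nz≈0) (·-zeroʳ (k / n))) ⟨
    (k % n) · z + (k / n) · n · z      ≈⟨ +-congˡ (×-assocˡ z (k / n) n) ⟩
    (k % n) · z + (k / n ℕ.* n) · z    ≈⟨ ×-homo-+ z (k % n) (k / n ℕ.* n) ⟨
    (k % n ℕ.+ k / n ℕ.* n) · z        ≈⟨ ×-congˡ (m≡m%n+[m/n]*n k n) ⟨
    k · z                              ∎

  mod-homo-+ : ∀ {z} n .{{_ : ℕ.NonZero n}} → n · z ≈ 0# → ∀ (i j : ℤ/ n) →
    toℕ (i +ₘ j) · z ≈ toℕ i · z + toℕ j · z
  mod-homo-+ {z} n nz≈0 i j = trans (mod-· n nz≈0 (toℕ i ℕ.+ toℕ j)) (×-homo-+ z (toℕ i) (toℕ j))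

  2·≈ : ∀ z → 2 · z ≈ z + z
  2·≈ z = +-congˡ (+-identityʳ z)

  ∘≈+λ : ∀ a b → a ∘ b ≈ a + λ-map a b
  ∘≈+λ a b = sym (+.\\-leftDividesˡ a (a ∘ b))

  λ-cong : ∀ {a b x y} → a ≈ b → x ≈ y → λ-map a x ≈ λ-map b y
  λ-cong a≈b x≈y = +-cong (-‿cong a≈b) (∘-cong a≈b x≈y)

  λ-homo-+ : ∀ a x y → λ-map a (x + y) ≈ λ-map a x + λ-map a y
  λ-homo-+ a x y = begin
    - a + a ∘ (x + y)              ≈⟨ +-congˡ (∘-skewDistrib a x y) ⟩
    - a + (a ∘ x - a + a ∘ y)      ≈⟨ +-congˡ (+-assoc _ _ _) ⟩
    - a + (a ∘ x + (- a + a ∘ y))  ≈⟨ +-assoc _ _ _ ⟨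
    λ-map a x + λ-map a y          ∎

  -- Expand `a ∘ (0# + 0#)` by skew distributivity and cancel one `a ∘ 0#`.
  ∘-zeroʳ : ∀ a → a ∘ 0# ≈ a
  ∘-zeroʳ a = +.x∙y⁻¹≈ε⇒x≈y _ _ $ +.∙-cancelʳ (a ∘ 0#) _ _ $ begin
    a ∘ 0# - a + a ∘ 0#  ≈⟨ ∘-skewDistrib a 0# 0# ⟨
    a ∘ (0# + 0#)        ≈⟨ ∘-congˡ (+-identityˡ 0#) ⟩
    a ∘ 0#               ≈⟨ +-identityˡ _ ⟨
    0# + a ∘ 0#          ∎

  e≈0 : e ≈ 0#
  e≈0 = trans (sym (∘-zeroʳ e)) (∘-identityˡ 0#)

  λ-zeroʳ : ∀ a → λ-map a 0# ≈ 0#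
  λ-zeroʳ a = trans (+-congˡ (∘-zeroʳ a)) (-‿inverseˡ a)

  λ-identity : ∀ x → λ-map e x ≈ x
  λ-identity x = begin
    - e + e ∘ x  ≈⟨ +-cong (trans (-‿cong e≈0) +.ε⁻¹≈ε) (∘-identityˡ x) ⟩
    0# + x       ≈⟨ +-identityˡ x ⟩
    x            ∎

  λ-homo-∘ : ∀ a b x → λ-map (a ∘ b) x ≈ λ-map a (λ-map b x)
  λ-homo-∘ a b x = begin
    - (a ∘ b) + a ∘ b ∘ x                      ≈⟨ +-congˡ (trans (∘-assoc a b x) (∘-congˡ (∘≈+λ b x))) ⟩
    - (a ∘ b) + a ∘ (b + λ-map b x)            ≈⟨ +-congˡ (∘-skewDistrib a b (λ-map b x)) ⟩
    - (a ∘ b) + (a ∘ b - a + a ∘ λ-map b x)    ≈⟨ +-congˡ (+-assoc _ _ _) ⟩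
    - (a ∘ b) + (a ∘ b + λ-map a (λ-map b x))  ≈⟨ +.\\-leftDividesʳ (a ∘ b) _ ⟩
    λ-map a (λ-map b x)                        ∎

  λ-inverseˡ : ∀ a x → λ-map (a ⁻¹) (λ-map a x) ≈ x
  λ-inverseˡ a x = begin
    λ-map (a ⁻¹) (λ-map a x)  ≈⟨ λ-homo-∘ (a ⁻¹) a x ⟨
    λ-map (a ⁻¹ ∘ a) x        ≈⟨ λ-cong (⁻¹-inverseˡ a) refl ⟩
    λ-map e x                 ≈⟨ λ-identity x ⟩
    x                         ∎

  -- Conjugation by `a` is trivial in an abelian group.
  θ≈λ : ∀ a b x → θ (a , b) x ≈ λ-map b x
  θ≈λ a b x = +.xyx⁻¹≈y a (λ-map b x)

  Fixed : Carrier → Set _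
  Fixed x = ∀ a → λ-map a x ≈ x

  Fixed-resp : ∀ {x y} → x ≈ y → Fixed x → Fixed y
  Fixed-resp x≈y Fx a = trans (λ-cong refl (sym x≈y)) (trans (Fx a) x≈y)

  Fixed-0 : Fixed 0#
  Fixed-0 = λ-zeroʳ

  Fixed-+ : ∀ {x y} → Fixed x → Fixed y → Fixed (x + y)
  Fixed-+ Fx Fy a = trans (λ-homo-+ a _ _) (+-cong (Fx a) (Fy a))

  Fixed-− : ∀ {x} → Fixed x → Fixed (- x)
  Fixed-− {x} Fx a = +.inverseʳ-unique x _ $ begin
    x + λ-map a (- x)          ≈⟨ +-congʳ (Fx a) ⟨
    λ-map a x + λ-map a (- x)  ≈⟨ λ-homo-+ a x (- x) ⟨
    λ-map a (x - x)            ≈⟨ λ-cong refl (-‿inverseʳ x) ⟩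
    λ-map a 0#                 ≈⟨ λ-zeroʳ a ⟩
    0#                         ∎

  Fixed-cancelʳ : ∀ {x y} → Fixed y → Fixed (x + y) → Fixed x
  Fixed-cancelʳ {x} {y} Fy Fx+y =
    Fixed-resp (+.//-rightDividesʳ y x) (Fixed-+ Fx+y (Fixed-− Fy))

  ¬Fixed-+ : ∀ {x y} → ¬ Fixed x → Fixed y → ¬ Fixed (x + y)
  ¬Fixed-+ ¬Fx Fy Fx+y = ¬Fx (Fixed-cancelʳ Fy Fx+y)

  -- If `λ-map a x` were fixed, `λ-map (a ⁻¹)` would leave it unchanged; but it sends it back to
  -- `x`.
  ¬Fixed-λ : ∀ {x} a → ¬ Fixed x → ¬ Fixed (λ-map a x)
  ¬Fixed-λ {x} a ¬Fx Fλ = ¬Fx (Fixed-resp (trans (sym (Fλ (a ⁻¹))) (λ-inverseˡ a x)) Fλ)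

  ∘-Fixedʳ : ∀ a {v} → Fixed v → a ∘ v ≈ a + v
  ∘-Fixedʳ a Fv = trans (∘≈+λ a _) (+-congˡ (Fv a))

  Fixed-· : ∀ k {v} → Fixed v → Fixed (k · v)
  Fixed-· zero    Fv = Fixed-0
  Fixed-· (suc k) Fv = Fixed-+ Fv (Fixed-· k Fv)

  λ-homo-· : ∀ a k y → λ-map a (k · y) ≈ k · λ-map a y
  λ-homo-· a zero    y = λ-zeroʳ a
  λ-homo-· a (suc k) y = trans (λ-homo-+ a y (k · y)) (+-congˡ (λ-homo-· a k y))

-- Decidability in a finite brace, and the orbit given by the single vertex.

module FiniteBrace (A : SkewBrace c ℓ) (+-comm : AdditivelyAbelian A) (fin : Finite A) where
  open Brace A +-comm public
  open Finite fin public
  open Inverse enumeration using (to; from; to-cong; from-cong; strictlyInverseˡ; strictlyInverseʳ)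

  -- Equal elements have propositionally equal representatives, so even a function that does not
  -- respect `_≈_` becomes well defined after composition with `canonical`.
  canonical : Carrier → Carrier
  canonical x = from (to x)

  canonical≈ : ∀ x → canonical x ≈ x
  canonical≈ = strictlyInverseʳ

  canonical-cong : ∀ {x y} → x ≈ y → canonical x ≡ canonical y
  canonical-cong x≈y = ≡.cong from (to-cong x≈y)

  to-injective : ∀ {x y} → to x ≡ to y → x ≈ y
  to-injective {x} {y} eq =
    trans (sym (canonical≈ x)) (trans (from-cong eq) (canonical≈ y))

  infix 4 _≟_

  _≟_ : ∀ x y → Dec (x ≈ y)
  x ≟ y = map′ to-injective to-cong (to x Fin.≟ to y)

  any? : {P : Pred Carrier p} → (∀ {x y} → x ≈ y → P x → P y) → Decidable P → Dec (∃ P)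
  any? resp P? = map′ (λ (i , pi) → from i , pi)
    (λ (x , px) → to x , resp (sym (canonical≈ x)) px) (Fin.any? λ i → P? (from i))

  injective⇒surjective-≈ : ∀ (f : Carrier → Carrier) → (∀ {x y} → f x ≈ f y → x ≈ y) →
    ∀ y → ∃ λ x → f x ≈ y
  injective⇒surjective-≈ f inj y =
    let i , eq = injective⇒surjective {f = λ i → to (f (from i))}
                   (λ {i} {j} eq → ≡.trans (≡.sym (strictlyInverseˡ i))
                     (≡.trans (to-cong (inj (to-injective eq))) (strictlyInverseˡ j)))
                   (to y)
    in from i , to-injective eq

  Fixed? : Decidable Fixed
  Fixed? x = map′ (λ f a → trans (λ-cong (sym (canonical≈ a)) refl) (f (to a))) (λ F i → F (from i))
    (Fin.all? λ i → λ-map (from i) x ≟ x)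

  InOrbit⇒λ : ∀ {x y} → InOrbit x y → ∃ λ a → λ-map a x ≈ y
  InOrbit⇒λ ((a , b) , eq) = b , trans (sym (θ≈λ a b _)) eq

  λ⇒InOrbit : ∀ {x y} a → λ-map a x ≈ y → InOrbit x y
  λ⇒InOrbit a eq = (0# , a) , trans (θ≈λ 0# a _) eq

  InOrbit? : ∀ x y → Dec (InOrbit x y)
  InOrbit? x y = map′ (λ (a , eq) → λ⇒InOrbit a eq) InOrbit⇒λ
    (any? (λ a≈b eq → trans (λ-cong (sym a≈b) refl) eq) (λ a → λ-map a x ≟ y))

  orbit : Carrier → Subset order
  orbit x = ⟦ (λ i → InOrbit? x (element i)) ⟧

  ∈orbit⇔ : ∀ x i → i ∈ orbit x ⇔ InOrbit x (element i)
  ∈orbit⇔ x = ∈⟦⟧⇔ (λ i → InOrbit? x (element i))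

  ¬Fixed⇒1<∣orbit∣ : ∀ {x} → ¬ Fixed x → 1 ℕ.< ∣ orbit x ∣
  ¬Fixed⇒1<∣orbit∣ {x} ¬Fx with any? (λ a≈b ¬eq eq → ¬eq (trans (λ-cong a≈b refl) eq)) (λ a → ¬? (λ-map a x ≟ x))
  ... | no ∄ = contradiction (λ a → decidable-stable (λ-map a x ≟ x) λ ¬eq → ∄ (a , ¬eq)) ¬Fx
  ... | yes (a , ¬eq) = ∈∧∈∧≢⇒1<∣∣
    (Equivalence.from (∈orbit⇔ x (to x)) (λ⇒InOrbit e (trans (λ-identity x) (sym (canonical≈ x)))))
    (Equivalence.from (∈orbit⇔ x (to (λ-map a x))) (λ⇒InOrbit a (sym (canonical≈ _))))
    λ eq → ¬eq (to-injective eq)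

  -- The orbit of a fixed point is contained in a singleton.
  1<∣IsOrbit∣⇒¬Fixed : ∀ {L} ((x , _) : IsOrbit A fin L) → 1 ℕ.< ∣ L ∣ → ¬ Fixed x
  1<∣IsOrbit∣⇒¬Fixed {L} (x , L⇔) 1<∣L∣ Fx = ℕ.<⇒≱ 1<∣L∣ $
    ≡.subst (∣ L ∣ ℕ.≤_) (∣⁅x⁆∣≡1 (to x)) $ p⊆q⇒∣p∣≤∣q∣ {p = L} λ {i} i∈L →
      let a , eq = InOrbit⇒λ (Equivalence.to (L⇔ i) i∈L)
          x≈i = trans (sym (Fx a)) eq
      in ≡.subst (_∈ ⁅ to x ⁆) (≡.trans (to-cong x≈i) (strictlyInverseˡ i)) (x∈⁅x⁆ (to x))

  -- The orbit of a non-fixed `y` is a vertex, hence equal to `L`; since it contains `y`, so does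
  -- the orbit of `x`.
  uniqueOrbit : HasExactlyOneVertex (Θ A fin) →
    ∃ λ x → ¬ Fixed x × (∀ y → Fixed y ⊎ ∃ λ a → λ-map a x ≈ y)
  uniqueOrbit ((L , L-orbit@(x , L⇔) , 1<∣L∣) , unique) =
    x , 1<∣IsOrbit∣⇒¬Fixed L-orbit 1<∣L∣ , classify
    where
    classify : ∀ y → Fixed y ⊎ ∃ λ a → λ-map a x ≈ y
    classify y with Fixed? y
    ... | yes Fy = inj₁ Fy
    ... | no ¬Fy =
      let L≡ = unique (orbit y , (y , ∈orbit⇔ y) , ¬Fixed⇒1<∣orbit∣ ¬Fy)
          y∈ = Equivalence.from (∈orbit⇔ y (to y)) (λ⇒InOrbit e (trans (λ-identity y) (sym (canonical≈ y))))
          a , eq = InOrbit⇒λ (Equivalence.to (L⇔ (to y)) (≡.subst (to y ∈_) (≡.sym L≡) y∈))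
      in inj₂ (a , trans eq (canonical≈ y))

  -- Counting: the stabiliser of `x` and the size of its orbit.

  module NonFixed (x : Carrier) (¬Fixed-x : ¬ Fixed x) where

    -- With a trivial stabiliser, `a ↦ λ-map a x` would be injective, hence surjective by
    -- finiteness, and would reach the fixed point `0#` from the non-fixed `x`.
    stabiliser-nontrivial : ∃ λ s → ¬ (s ≈ e) × λ-map s x ≈ x
    stabiliser-nontrivial with any? {P = λ s → ¬ (s ≈ e) × λ-map s x ≈ x}
      (λ s≈t (s≉e , eq) → (λ t≈e → s≉e (trans s≈t t≈e)) , trans (λ-cong (sym s≈t) refl) eq)
      (λ s → ¬? (s ≟ e) ×-dec (λ-map s x ≟ x))
    ... | yes s = s
    ... | no ∄ =
        let λx-injective : ∀ {a b} → λ-map a x ≈ λ-map b x → a ≈ b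
            λx-injective {a} {b} eq = sym $ begin
              b               ≈⟨ ∘.\\-leftDividesˡ a b ⟨
              a ∘ (a ⁻¹ ∘ b)  ≈⟨ ∘-congˡ (decidable-stable (a ⁻¹ ∘ b ≟ e) λ ≉e → ∄ (a ⁻¹ ∘ b , ≉e , (begin
                λ-map (a ⁻¹ ∘ b) x        ≈⟨ λ-homo-∘ (a ⁻¹) b x ⟩
                λ-map (a ⁻¹) (λ-map b x)  ≈⟨ λ-cong refl eq ⟨
                λ-map (a ⁻¹) (λ-map a x)  ≈⟨ λ-inverseˡ a x ⟩
                x                         ∎))) ⟩
              a ∘ e           ≈⟨ ∘-identityʳ a ⟩
              a               ∎
            a , λax≈0 = injective⇒surjective-≈ (λ a → λ-map a x) λx-injective 0#
        in contradiction (Fixed-resp (sym λax≈0) Fixed-0) (¬Fixed-λ a ¬Fixed-x)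

  module Packing (x : Carrier) (¬Fixed-x : ¬ Fixed x)
    (classify : ∀ y → Fixed y ⊎ ∃ λ a → λ-map a x ≈ y)
    (s : Carrier) (s≉e : ¬ (s ≈ e)) (λsx≈x : λ-map s x ≈ x) where

    -- A choice of element carrying `x` to `y`. The value `e` at fixed `y` is a mere default;
    -- passing through `canonical` makes the choice respect `_≈_`.
    mover : Carrier → Carrier
    mover y = [ (λ _ → e) , proj₁ ]′ (classify (canonical y))

    mover-cong : ∀ {y z} → y ≈ z → mover y ≈ mover z
    mover-cong y≈z =
      reflexive (≡.cong (λ w → [ (λ _ → e) , proj₁ ]′ (classify w)) (canonical-cong y≈z))

    λ-mover : ∀ {y} → ¬ Fixed y → λ-map (mover y) x ≈ y
    λ-mover {y} ¬Fy with classify (canonical y)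
    ... | inj₁ F = contradiction (Fixed-resp (canonical≈ y) F) ¬Fy
    ... | inj₂ (a , eq) = trans eq (canonical≈ y)

    λ-mover-s : ∀ {y} → ¬ Fixed y → λ-map (mover y ∘ s) x ≈ y
    λ-mover-s ¬Fy = trans (λ-homo-∘ _ s x) (trans (λ-cong refl λsx≈x) (λ-mover ¬Fy))

    mover≉mover∘s : ∀ {y z} → y ≈ z → ¬ (mover y ≈ mover z ∘ s)
    mover≉mover∘s {y} {z} y≈z eq = s≉e $ ∘.∙-cancelˡ (mover z) s e
      (trans (sym eq) (trans (mover-cong y≈z) (sym (∘-identityʳ _))))

    -- Each y in the orbit of x is reached from x by both mover y and mover y ∘ s, so
    -- orbit ⊎ orbit embeds in A; and the translate x + F of the fixed points F lies in
    -- the orbit.  pack is the composite A = F ⊎ orbit → orbit ⊎ orbit → A.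
    pack : ∀ a → Dec (Fixed a) → Carrier
    pack a (yes _) = mover (x + a)
    pack a (no _)  = mover a ∘ s

    -- Acting on `x` recovers `x + a` or `a` from the value of `pack`. In the mixed cases both sides
    -- carry `x` to the same point, but one is the chosen mover and the other its product with `s`,
    -- so they differ.
    pack-injective : ∀ {a b} (a? : Dec (Fixed a)) (b? : Dec (Fixed b)) → pack a a? ≈ pack b b? → a ≈ b
    pack-injective {a} {b} (yes Fa) (yes Fb) eq = +.∙-cancelˡ x a b $
      trans (sym (λ-mover (¬Fixed-+ ¬Fixed-x Fa))) (trans (λ-cong eq refl) (λ-mover (¬Fixed-+ ¬Fixed-x Fb)))
    pack-injective {a} {b} (yes Fa) (no ¬Fb) eq = contradiction eq $ mover≉mover∘s $
      trans (sym (λ-mover (¬Fixed-+ ¬Fixed-x Fa))) (trans (λ-cong eq refl) (λ-mover-s ¬Fb))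
    pack-injective {a} {b} (no ¬Fa) (yes Fb) eq = contradiction (sym eq) $ mover≉mover∘s $
      trans (sym (λ-mover (¬Fixed-+ ¬Fixed-x Fb))) (trans (λ-cong (sym eq) refl) (λ-mover-s ¬Fa))
    pack-injective {a} {b} (no ¬Fa) (no ¬Fb) eq =
      trans (sym (λ-mover-s ¬Fa)) (trans (λ-cong eq refl) (λ-mover-s ¬Fb))

    pack-surjective : ∀ y → ∃ λ a → pack a (Fixed? a) ≈ y
    pack-surjective = injective⇒surjective-≈ (λ a → pack a (Fixed? a))
      λ {a} {b} → pack-injective (Fixed? a) (Fixed? b)

    -- By surjectivity `mover y` is a value of `pack`. It cannot come from a non-fixed element,
    -- which would give a product with `s`, so it is `mover (x + a)` with `a` fixed, whence
    -- `x + a ≈ y`.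
    coset-x : ∀ {y} → ¬ Fixed y → Fixed (y - x)
    coset-x {y} ¬Fy = let a , eq = pack-surjective (mover y) in fibre a (Fixed? a) eq
      where
      fibre : ∀ a (a? : Dec (Fixed a)) → pack a a? ≈ mover y → Fixed (y - x)
      fibre a (yes Fa) eq = Fixed-resp (begin
        a                            ≈⟨ +.xyx⁻¹≈y x a ⟨
        x + a - x                    ≈⟨ +-congʳ (λ-mover (¬Fixed-+ ¬Fixed-x Fa)) ⟨
        λ-map (mover (x + a)) x - x  ≈⟨ +-congʳ (λ-cong eq refl) ⟩
        λ-map (mover y) x - x        ≈⟨ +-congʳ (λ-mover ¬Fy) ⟩
        y - x                        ∎) Fa
      fibre a (no ¬Fa) eq = contradiction (sym eq) $ mover≉mover∘s $
        trans (sym (λ-mover ¬Fy)) (trans (λ-cong (sym eq) refl) (λ-mover-s ¬Fa))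

    -- Every `t` is a value of `pack`, so it is `mover z` or `mover z ∘ s` for the point `z` to
    -- which it carries `x`; here `z` is `x`.
    stabiliser⊆ : ∀ {t} → λ-map t x ≈ x → t ≈ mover x ⊎ t ≈ mover x ∘ s
    stabiliser⊆ {t} λtx≈x = let a , eq = pack-surjective t in fibre a (Fixed? a) eq
      where
      fibre : ∀ a (a? : Dec (Fixed a)) → pack a a? ≈ t → t ≈ mover x ⊎ t ≈ mover x ∘ s
      fibre a (yes Fa) eq = inj₁ (trans (sym eq) (mover-cong
        (trans (sym (λ-mover (¬Fixed-+ ¬Fixed-x Fa))) (trans (λ-cong eq refl) λtx≈x))))
      fibre a (no ¬Fa) eq = inj₂ (trans (sym eq) (∘-congʳ (mover-cong
        (trans (sym (λ-mover-s ¬Fa)) (trans (λ-cong eq refl) λtx≈x)))))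

    -- The choice `mover x` need not be `e`. But `e`, `s` and `t` all lie among the two elements of
    -- `stabiliser⊆`, and `e` and `s` are distinct.
    stabiliser : ∀ {t} → λ-map t x ≈ x → t ≈ e ⊎ t ≈ s
    stabiliser {t} λtx≈x =
      compare (mover x) (stabiliser⊆ (λ-identity x)) (stabiliser⊆ λsx≈x) (stabiliser⊆ λtx≈x)
      where
      compare : ∀ u → e ≈ u ⊎ e ≈ u ∘ s → s ≈ u ⊎ s ≈ u ∘ s → t ≈ u ⊎ t ≈ u ∘ s → t ≈ e ⊎ t ≈ s
      compare u (inj₁ e≈u)  _           (inj₁ t≈u)  = inj₁ (trans t≈u (sym e≈u))
      compare u (inj₁ e≈u)  _           (inj₂ t≈us) =
        inj₂ (trans t≈us (trans (∘-congʳ (sym e≈u)) (∘-identityˡ s)))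
      compare u (inj₂ e≈us) (inj₂ s≈us) _           = contradiction (trans s≈us (sym e≈us)) s≉e
      compare u (inj₂ _)    (inj₁ s≈u)  (inj₁ t≈u)  = inj₂ (trans t≈u (sym s≈u))
      compare u (inj₂ e≈us) (inj₁ _)    (inj₂ t≈us) = inj₁ (trans t≈us (sym e≈us))

  -- The homomorphism `δ` and its relations.

  module HalfFixed (x : Carrier) (¬Fixed-x : ¬ Fixed x)
    (classify : ∀ y → Fixed y ⊎ ∃ λ a → λ-map a x ≈ y)
    (coset-x : ∀ {y} → ¬ Fixed y → Fixed (y - x))
    (s : Carrier) (s≉e : ¬ (s ≈ e)) (λsx≈x : λ-map s x ≈ x)
    (stabiliser : ∀ {t} → λ-map t x ≈ x → t ≈ e ⊎ t ≈ s) where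

    coset : ∀ {y z} → ¬ Fixed y → ¬ Fixed z → Fixed (z - y)
    coset {y} {z} ¬Fy ¬Fz = Fixed-resp (begin
      z - x - (y - x)        ≈⟨ +-congˡ (+.⁻¹-anti-homo‿- y x) ⟩
      z - x + (x - y)        ≈⟨ +-assoc z (- x) (x - y) ⟩
      z + (- x + (x - y))    ≈⟨ +-congˡ (+.\\-leftDividesʳ x (- y)) ⟩
      z - y                  ∎)
      (Fixed-+ (coset-x ¬Fz) (Fixed-− (coset-x ¬Fy)))

    δ : Carrier → Carrier
    δ a = λ-map a x - x

    λx≈x+δ : ∀ a → λ-map a x ≈ x + δ a
    λx≈x+δ a = sym (y+[z-y]≈z x (λ-map a x))

    δ-unique : ∀ {a v} → λ-map a x ≈ x + v → δ a ≈ v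
    δ-unique {v = v} eq = trans (+-congʳ eq) (+.xyx⁻¹≈y x v)

    δ-cong : ∀ {a b} → a ≈ b → δ a ≈ δ b
    δ-cong a≈b = +-congʳ (λ-cong a≈b refl)

    Fixed-δ : ∀ a → Fixed (δ a)
    Fixed-δ a = coset-x (¬Fixed-λ a ¬Fixed-x)

    -- Non-fixed elements differ from `x` by fixed ones, so `λ-map a` shifts them all by the same
    -- amount.
    λ≈+δ : ∀ a {y} → ¬ Fixed y → λ-map a y ≈ y + δ a
    λ≈+δ a {y} ¬Fy = begin
      λ-map a y                        ≈⟨ λ-cong refl (y+[z-y]≈z x y) ⟨
      λ-map a (x + (y - x))            ≈⟨ λ-homo-+ a x (y - x) ⟩
      λ-map a x + λ-map a (y - x)      ≈⟨ +-cong (λx≈x+δ a) (coset-x ¬Fy a) ⟩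
      x + δ a + (y - x)                ≈⟨ solve 3 (λ x d v → (x ⊕ d) ⊕ v ⊜ (x ⊕ v) ⊕ d) refl x (δ a) (y - x) ⟩
      x + (y - x) + δ a                ≈⟨ +-congʳ (y+[z-y]≈z x y) ⟩
      y + δ a                          ∎

    δ-homo-∘ : ∀ a b → δ (a ∘ b) ≈ δ a + δ b
    δ-homo-∘ a b = δ-unique $ begin
      λ-map (a ∘ b) x            ≈⟨ λ-homo-∘ a b x ⟩
      λ-map a (λ-map b x)        ≈⟨ λ≈+δ a (¬Fixed-λ b ¬Fixed-x) ⟩
      λ-map b x + δ a            ≈⟨ +-congʳ (λx≈x+δ b) ⟩
      x + δ b + δ a              ≈⟨ solve 3 (λ x d v → (x ⊕ d) ⊕ v ⊜ x ⊕ (v ⊕ d)) refl x (δ b) (δ a) ⟩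
      x + (δ a + δ b)            ∎

    δ-homo-+ : ∀ a {v} → Fixed v → δ (a + v) ≈ δ a + δ v
    δ-homo-+ a Fv = trans (δ-cong (sym (∘-Fixedʳ a Fv))) (δ-homo-∘ a _)

    -- The element `x + v` is not fixed, so it lies in the orbit of `x`.
    δ-surjective : ∀ {v} → Fixed v → ∃ λ a → δ a ≈ v
    δ-surjective {v} Fv with classify (x + v)
    ... | inj₁ F = contradiction F (¬Fixed-+ ¬Fixed-x Fv)
    ... | inj₂ (a , eq) = a , δ-unique eq

    -- Otherwise `x + x` would differ from `x` by a fixed element, and that difference is `x`.
    Fixed-x+x : Fixed (x + x)
    Fixed-x+x with Fixed? (x + x)
    ... | yes F = F
    ... | no ¬F = contradiction (Fixed-resp (+.xyx⁻¹≈y x x) (coset-x ¬F)) ¬Fixed-x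

    -- Additivity makes `λ-map a` shift `x + x` by `δ a` twice, yet `x + x` is fixed.
    δ+δ≈0 : ∀ a → δ a + δ a ≈ 0#
    δ+δ≈0 a = +.identityʳ-unique (x + x) _ $ begin
      x + x + (δ a + δ a)      ≈⟨ solve 2 (λ x d → (x ⊕ x) ⊕ (d ⊕ d) ⊜ (x ⊕ d) ⊕ (x ⊕ d)) refl x (δ a) ⟩
      x + δ a + (x + δ a)      ≈⟨ +-cong (λx≈x+δ a) (λx≈x+δ a) ⟨
      λ-map a x + λ-map a x    ≈⟨ λ-homo-+ a x x ⟨
      λ-map a (x + x)          ≈⟨ Fixed-x+x a ⟩
      x + x                    ∎

    Fixed⇒+≈0 : ∀ {v} → Fixed v → v + v ≈ 0#
    Fixed⇒+≈0 Fv = let a , eq = δ-surjective Fv in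
      trans (+-cong (sym eq) (sym eq)) (δ+δ≈0 a)

    ∘x≈ : ∀ a → a ∘ x ≈ x + a + δ a
    ∘x≈ a = begin
      a ∘ x            ≈⟨ ∘≈+λ a x ⟩
      a + λ-map a x    ≈⟨ +-congˡ (λx≈x+δ a) ⟩
      a + (x + δ a)    ≈⟨ solve 3 (λ a x d → a ⊕ (x ⊕ d) ⊜ (x ⊕ a) ⊕ d) refl a x (δ a) ⟩
      x + a + δ a      ∎

    δδ≈0 : ∀ {a} → Fixed a → δ (δ a) ≈ 0#
    δδ≈0 {a} Fa = +.identityʳ-unique (δ x + δ a) _ $ begin
      δ x + δ a + δ (δ a)      ≈⟨ +-congʳ (δ-homo-+ x Fa) ⟨
      δ (x + a) + δ (δ a)      ≈⟨ δ-homo-+ (x + a) (Fixed-δ a) ⟨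
      δ (x + a + δ a)          ≈⟨ δ-cong (∘x≈ a) ⟨
      δ (a ∘ x)                ≈⟨ δ-homo-∘ a x ⟩
      δ a + δ x                ≈⟨ +-comm (δ a) (δ x) ⟩
      δ x + δ a                ∎

    δ[x+x]+δδx≈0 : δ (x + x) + δ (δ x) ≈ 0#
    δ[x+x]+δδx≈0 = begin
      δ (x + x) + δ (δ x)      ≈⟨ δ-homo-+ (x + x) (Fixed-δ x) ⟨
      δ (x + x + δ x)          ≈⟨ δ-cong (∘x≈ x) ⟨
      δ (x ∘ x)                ≈⟨ δ-homo-∘ x x ⟩
      δ x + δ x                ≈⟨ δ+δ≈0 x ⟩
      0#                       ∎

    δ-kernel : ∀ {t} → δ t ≈ 0# → t ≈ 0# ⊎ t ≈ s
    δ-kernel {t} δt≈0 with stabiliser (trans (λx≈x+δ t) (trans (+-congˡ δt≈0) (+-identityʳ x)))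
    ... | inj₁ t≈e = inj₁ (trans t≈e e≈0)
    ... | inj₂ t≈s = inj₂ t≈s

    δ0≈0 : δ 0# ≈ 0#
    δ0≈0 = δ-unique (trans (λ-cong (sym e≈0) refl) (trans (λ-identity x) (sym (+-identityʳ x))))

    δs≈0 : δ s ≈ 0#
    δs≈0 = trans (+-congʳ λsx≈x) (-‿inverseʳ x)

    s≉0 : ¬ (s ≈ 0#)
    s≉0 s≈0 = s≉e (trans s≈0 (sym e≈0))

    ∃δ≉0 : ∃ λ a → ¬ (δ a ≈ 0#)
    ∃δ≉0 with any? (λ a≈b ≉0 ≈0 → ≉0 (trans (δ-cong a≈b) ≈0)) (λ a → ¬? (δ a ≟ 0#))
    ... | yes a = a
    ... | no ∄ = contradiction
      (λ a → trans (λx≈x+δ a) (trans (+-congˡ (decidable-stable (δ a ≟ 0#) λ ≉0 → ∄ (a , ≉0))) (+-identityʳ x)))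
      ¬Fixed-x

    -- Otherwise δ would be injective on the fixed points, on which δ ∘ δ vanishes.
    Fixed-s : Fixed s
    Fixed-s = decidable-stable (Fixed? s) λ ¬Fs →
      let a , δa≉0 = ∃δ≉0
          kernel-Fixed : ∀ {v} → Fixed v → δ v ≈ 0# → v ≈ 0#
          kernel-Fixed Fv δv≈0 = case δ-kernel δv≈0 of λ where
            (inj₁ v≈0) → v≈0
            (inj₂ v≈s) → contradiction (Fixed-resp v≈s Fv) ¬Fs
      in δa≉0 (kernel-Fixed (Fixed-δ a) (kernel-Fixed (Fixed-δ (δ a)) (δδ≈0 (Fixed-δ a))))

    -- Each isomorphism below writes elements as a fixed part plus a multiple of a non-fixed
    -- generator. The last term is the deviation of `_∘_` from `_+_`, to be matched with the
    -- correction terms of the model braces.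
    ∘≈+·δ : ∀ a {v y} k → Fixed v → ¬ Fixed y → a ∘ (v + k · y) ≈ a + (v + k · y) + k · δ a
    ∘≈+·δ a {v} {y} k Fv ¬Fy = begin
      a ∘ (v + k · y)                          ≈⟨ ∘≈+λ a _ ⟩
      a + λ-map a (v + k · y)                  ≈⟨ +-congˡ (λ-homo-+ a v (k · y)) ⟩
      a + (λ-map a v + λ-map a (k · y))        ≈⟨ +-congˡ (+-cong (Fv a) (λ-homo-· a k y)) ⟩
      a + (v + k · λ-map a y)                  ≈⟨ +-congˡ (+-congˡ (×-congʳ k (λ≈+δ a ¬Fy))) ⟩
      a + (v + k · (y + δ a))                  ≈⟨ +-congˡ (+-congˡ (×-distrib-+ y (δ a) k)) ⟩
      a + (v + (k · y + k · δ a))              ≈⟨ solve 4 (λ a v y d → a ⊕ (v ⊕ (y ⊕ d)) ⊜ (a ⊕ (v ⊕ y)) ⊕ d) refl a v (k · y) (k · δ a) ⟩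
      a + (v + k · y) + k · δ a                ∎

    2·δ≈0 : ∀ a → 2 · δ a ≈ 0#
    2·δ≈0 a = trans (+-congˡ (+-identityʳ _)) (δ+δ≈0 a)

    3·δ≈δ : ∀ a → 3 · δ a ≈ δ a
    3·δ≈δ a = trans (+-congˡ (2·δ≈0 a)) (+-identityʳ _)

    coset? : ∀ {y} → ¬ Fixed y → ∀ z → Fixed z ⊎ Fixed (z - y)
    coset? ¬Fy z with Fixed? z
    ... | yes Fz = inj₁ Fz
    ... | no ¬Fz = inj₂ (coset ¬Fy ¬Fz)

    -- The isomorphism with `B₁`, with `x` as additive generator.

    module Case₁ (δx≈s : δ x ≈ s) (fixed : ∀ {v} → Fixed v → v ≈ 0# ⊎ v ≈ s) (x+x≈s : x + x ≈ s) where

      s+s≈0 : s + s ≈ 0#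
      s+s≈0 = Fixed⇒+≈0 Fixed-s

      g : ℤ/ 4 → Carrier
      g j = toℕ j · x

      3·x≈ : 3 · x ≈ x + s
      3·x≈ = +-congˡ (trans (2·≈ x) x+x≈s)

      4·x≈0 : 4 · x ≈ 0#
      4·x≈0 = begin
        x + 3 · x      ≈⟨ +-congˡ 3·x≈ ⟩
        x + (x + s)    ≈⟨ +-assoc x x s ⟨
        x + x + s      ≈⟨ +-congʳ x+x≈s ⟩
        s + s          ≈⟨ s+s≈0 ⟩
        0#             ∎

      g-+ : ∀ i j → g (i +ₘ j) ≈ g i + g j
      g-+ = mod-homo-+ 4 4·x≈0

      twist₁ : ∀ j → δ (g j) ≈ g (2F *ₘ j *ₘ 1F)
      twist₁ 0F = δ0≈0
      twist₁ 1F = trans (δ-cong (×-homo-1 x)) (trans δx≈s (sym (trans (2·≈ x) x+x≈s)))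
      twist₁ 2F = trans (δ-cong (trans (2·≈ x) x+x≈s)) δs≈0
      twist₁ 3F = begin
        δ (3 · x)    ≈⟨ δ-cong 3·x≈ ⟩
        δ (x + s)    ≈⟨ δ-homo-+ x Fixed-s ⟩
        δ x + δ s    ≈⟨ +-cong δx≈s δs≈0 ⟩
        s + 0#       ≈⟨ +-identityʳ s ⟩
        s            ≈⟨ trans (2·≈ x) x+x≈s ⟨
        2 · x        ∎

      -- Since `2 · δ a ≈ 0#`, only the parity of `j` matters, and `twist₁` settles both odd
      -- columns.
      twist : ∀ i j → g (2F *ₘ i *ₘ j) ≈ toℕ j · δ (g i)
      twist 0F 0F = refl
      twist 1F 0F = refl
      twist 2F 0F = refl
      twist 3F 0F = refl
      twist i  1F = trans (sym (twist₁ i)) (sym (×-homo-1 _))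
      twist 0F 2F = sym (2·δ≈0 _)
      twist 1F 2F = sym (2·δ≈0 _)
      twist 2F 2F = sym (2·δ≈0 _)
      twist 3F 2F = sym (2·δ≈0 _)
      twist 0F 3F = trans (sym (twist₁ 0F)) (sym (3·δ≈δ _))
      twist 1F 3F = trans (sym (twist₁ 1F)) (sym (3·δ≈δ _))
      twist 2F 3F = trans (sym (twist₁ 2F)) (sym (3·δ≈δ _))
      twist 3F 3F = trans (sym (twist₁ 3F)) (sym (3·δ≈δ _))

      g-∘ : ∀ i j → g (i B₁.∘ j) ≈ g i ∘ g j
      g-∘ i j = begin
        g (i B₁.∘ j)                         ≈⟨ g-+ (i +ₘ j) _ ⟩
        g (i +ₘ j) + g (2F *ₘ i *ₘ j)        ≈⟨ +-cong (g-+ i j) (twist i j) ⟩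
        -- Multiples of `x` alone exhaust this case, so `0#` stands in for the fixed part in
        -- `∘≈+·δ`.
        g i + g j + toℕ j · δ (g i)          ≈⟨ +-congʳ (+-congˡ (+-identityˡ (g j))) ⟨
        g i + (0# + g j) + toℕ j · δ (g i)   ≈⟨ ∘≈+·δ (g i) (toℕ j) Fixed-0 ¬Fixed-x ⟨
        g i ∘ (0# + g j)                     ≈⟨ ∘-congˡ (+-identityˡ (g j)) ⟩
        g i ∘ g j                            ∎

      iso : A ≅ B₁
      iso = ≅-fromHom A B₁ g (λ { ≡.refl → refl }) g-+ g-∘ kernel surj
        where
        kernel : ∀ j → g j ≈ 0# → j ≡ 0F
        kernel 0F _ = ≡.refl
        kernel 1F ≈0 = contradiction (Fixed-resp (trans (sym ≈0) (×-homo-1 x)) Fixed-0) ¬Fixed-x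
        kernel 2F ≈0 = contradiction (trans (sym (trans (2·≈ x) x+x≈s)) ≈0) s≉0
        kernel 3F ≈0 = contradiction (Fixed-resp (trans (sym ≈0) 3·x≈) Fixed-0) (¬Fixed-+ ¬Fixed-x Fixed-s)

        surj : ∀ y → ∃ λ j → g j ≈ y
        surj y with coset? ¬Fixed-x y
        ... | inj₁ Fy = case fixed Fy of λ where
          (inj₁ y≈0) → 0F , sym y≈0
          (inj₂ y≈s) → 2F , trans (2·≈ x) (trans x+x≈s (sym y≈s))
        ... | inj₂ Fy-x = case fixed Fy-x of λ where
          (inj₁ ≈0) → 1F , trans (+-congˡ (sym ≈0)) (y+[z-y]≈z x y)
          (inj₂ ≈s) → 3F , trans 3·x≈ (trans (+-congˡ (sym ≈s)) (y+[z-y]≈z x y))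

    -- Coordinates with respect to `s` and a non-fixed generator; the isomorphisms with `B₂` and
    -- `B₃`.

    2·s≈0 : 2 · s ≈ 0#
    2·s≈0 = trans (2·≈ s) (Fixed⇒+≈0 Fixed-s)

    δ-·s≈0 : ∀ (i : ℤ/ 2) → δ (toℕ i · s) ≈ 0#
    δ-·s≈0 0F = δ0≈0
    δ-·s≈0 1F = trans (δ-cong (×-homo-1 s)) δs≈0

    module Combination (y : Carrier) (n : ℕ) .{{_ : ℕ.NonZero n}} (n·y≈0 : n · y ≈ 0#) where

      g : ℤ/ 2 × ℤ/ n → Carrier
      g (i , j) = toℕ i · s + toℕ j · y

      g-+ : ∀ i j i′ j′ → g (i +ₘ i′ , j +ₘ j′) ≈ g (i , j) + g (i′ , j′)
      g-+ i j i′ j′ = trans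
        (+-cong (mod-homo-+ 2 2·s≈0 i i′) (mod-homo-+ n n·y≈0 j j′))
        (solve 4 (λ a b c d → (a ⊕ b) ⊕ (c ⊕ d) ⊜ (a ⊕ c) ⊕ (b ⊕ d)) refl
          (toℕ i · s) (toℕ i′ · s) (toℕ j · y) (toℕ j′ · y))

      δ-g : ∀ i j → δ (g (i , j)) ≈ δ (toℕ j · y)
      δ-g i j = begin
        δ (toℕ i · s + toℕ j · y)        ≈⟨ δ-cong (+-comm _ _) ⟩
        δ (toℕ j · y + toℕ i · s)        ≈⟨ δ-homo-+ _ (Fixed-· (toℕ i) Fixed-s) ⟩
        δ (toℕ j · y) + δ (toℕ i · s)    ≈⟨ +-congˡ (δ-·s≈0 i) ⟩
        δ (toℕ j · y) + 0#               ≈⟨ +-identityʳ _ ⟩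
        δ (toℕ j · y)                    ∎

      -- Here `(k , l)` is the correction term in coordinates. Because `δ` ignores the multiple of
      -- `s`, the correction depends only on `j` and `j′`.
      g-∘ : ¬ Fixed y → ∀ i j i′ j′ k l → g (k , l) ≈ toℕ j′ · δ (toℕ j · y) →
        g (i +ₘ i′ +ₘ k , j +ₘ j′ +ₘ l) ≈ g (i , j) ∘ g (i′ , j′)
      g-∘ ¬Fy i j i′ j′ k l twist = begin
        g (i +ₘ i′ +ₘ k , j +ₘ j′ +ₘ l)                      ≈⟨ g-+ (i +ₘ i′) (j +ₘ j′) k l ⟩
        g (i +ₘ i′ , j +ₘ j′) + g (k , l)                    ≈⟨ +-cong (g-+ i j i′ j′) (trans twist (×-congʳ (toℕ j′) (sym (δ-g i j)))) ⟩
        g (i , j) + g (i′ , j′) + toℕ j′ · δ (g (i , j))     ≈⟨ ∘≈+·δ _ (toℕ j′) (Fixed-· (toℕ i′) Fixed-s) ¬Fy ⟨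
        g (i , j) ∘ g (i′ , j′)                              ∎

    module Case₂ (δx≈s : δ x ≈ s) (fixed : ∀ {v} → Fixed v → v ≈ 0# ⊎ v ≈ s) (x+x≈0 : x + x ≈ 0#) where

      open Combination x 2 (trans (2·≈ x) x+x≈0)

      twist : ∀ j j′ → g (j *ₘ j′ , 0F) ≈ toℕ j′ · δ (toℕ j · x)
      twist 0F 0F = +-identityʳ 0#
      twist 1F 0F = +-identityʳ 0#
      twist 0F 1F = trans (+-identityʳ 0#) (sym (trans (×-homo-1 _) δ0≈0))
      twist 1F 1F = begin
        1 · s + 0#       ≈⟨ +-identityʳ _ ⟩
        1 · s            ≈⟨ ×-congʳ 1 δx≈s ⟨
        1 · δ x          ≈⟨ ×-congʳ 1 (δ-cong (×-homo-1 x)) ⟨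
        1 · δ (1 · x)    ∎

      -- The second coordinate of `B₂` has no correction term; this reconciles it with the `0F`
      -- added by `g-∘`.
      +ₘ-identityʳ : ∀ (j : ℤ/ 2) → j +ₘ 0F ≡ j
      +ₘ-identityʳ 0F = ≡.refl
      +ₘ-identityʳ 1F = ≡.refl

      iso : A ≅ B₂
      iso = ≅-fromHom A B₂ g (λ { ≡.refl → refl }) (λ (i , j) (i′ , j′) → g-+ i j i′ j′)
        (λ (i , j) (i′ , j′) → trans
          (reflexive (≡.cong (λ l → g (i +ₘ i′ +ₘ j *ₘ j′ , l)) (≡.sym (+ₘ-identityʳ (j +ₘ j′)))))
          (g-∘ ¬Fixed-x i j i′ j′ (j *ₘ j′) 0F (twist j j′)))
        kernel surj
        where
        1,0 : g (1F , 0F) ≈ s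
        1,0 = trans (+-identityʳ _) (×-homo-1 s)
        0,1 : g (0F , 1F) ≈ x
        0,1 = trans (+-identityˡ _) (×-homo-1 x)
        1,1 : g (1F , 1F) ≈ x + s
        1,1 = trans (+-cong (×-homo-1 s) (×-homo-1 x)) (+-comm s x)

        kernel : ∀ ij → g ij ≈ 0# → ij ≡ (0F , 0F)
        kernel (0F , 0F) _ = ≡.refl
        kernel (1F , 0F) ≈0 = contradiction (trans (sym 1,0) ≈0) s≉0
        kernel (0F , 1F) ≈0 = contradiction (Fixed-resp (trans (sym ≈0) 0,1) Fixed-0) ¬Fixed-x
        kernel (1F , 1F) ≈0 = contradiction (Fixed-resp (trans (sym ≈0) 1,1) Fixed-0) (¬Fixed-+ ¬Fixed-x Fixed-s)

        surj : ∀ y → ∃ λ ij → g ij ≈ y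
        surj y with coset? ¬Fixed-x y
        ... | inj₁ Fy = case fixed Fy of λ where
          (inj₁ y≈0) → (0F , 0F) , trans (+-identityʳ 0#) (sym y≈0)
          (inj₂ y≈s) → (1F , 0F) , trans 1,0 (sym y≈s)
        ... | inj₂ Fy-x = case fixed Fy-x of λ where
          (inj₁ ≈0) → (0F , 1F) , trans 0,1 (trans (trans (sym (+-identityʳ x)) (+-congˡ (sym ≈0))) (y+[z-y]≈z x y))
          (inj₂ ≈s) → (1F , 1F) , trans 1,1 (trans (+-congˡ (sym ≈s)) (y+[z-y]≈z x y))

    module Case₃ (y : Carrier) (¬Fixed-y : ¬ Fixed y) (y+y≈δy : y + y ≈ δ y) (δδy≈s : δ (δ y) ≈ s)
      (fixed : ∀ {v} → Fixed v → ∃ λ (i : ℤ/ 2) → v ≈ toℕ i · s ⊎ v ≈ toℕ i · s + δ y) where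

      2·y≈δy : 2 · y ≈ δ y
      2·y≈δy = trans (2·≈ y) y+y≈δy

      3·y≈ : 3 · y ≈ y + δ y
      3·y≈ = +-congˡ 2·y≈δy

      4·y≈0 : 4 · y ≈ 0#
      4·y≈0 = begin
        y + 3 · y        ≈⟨ +-congˡ 3·y≈ ⟩
        y + (y + δ y)    ≈⟨ +-assoc y y (δ y) ⟨
        y + y + δ y      ≈⟨ +-congʳ y+y≈δy ⟩
        δ y + δ y        ≈⟨ δ+δ≈0 y ⟩
        0#               ∎

      open Combination y 4 4·y≈0

      0,0 : g (0F , 0F) ≈ 0#
      0,0 = +-identityʳ 0#

      1,0 : g (1F , 0F) ≈ s
      1,0 = trans (+-identityʳ _) (×-homo-1 s)

      i,2 : ∀ i → g (i , 2F) ≈ toℕ i · s + δ y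
      i,2 i = +-congˡ 2·y≈δy

      δ[1·y] : δ (1 · y) ≈ δ y
      δ[1·y] = δ-cong (×-homo-1 y)

      δ[2·y] : δ (2 · y) ≈ s
      δ[2·y] = trans (δ-cong 2·y≈δy) δδy≈s

      δ[3·y] : δ (3 · y) ≈ δ y + s
      δ[3·y] = trans (δ-cong 3·y≈) (trans (δ-homo-+ y (Fixed-δ y)) (+-congˡ δδy≈s))

      -- The multiples of `y` have `δ`-values `0#`, `δ y`, `s` and `δ y + s`. With `2 · y ≈ δ y`,
      -- their coordinates along `s` are the values of `ε`, and those along `y` are `2j`.
      twist₁ : ∀ j → g (B₃.ε j *ₘ 1F , 2F *ₘ j *ₘ 1F) ≈ δ (toℕ j · y)
      twist₁ 0F = trans 0,0 (sym δ0≈0)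
      twist₁ 1F = trans (i,2 0F) (trans (+-identityˡ _) (sym δ[1·y]))
      twist₁ 2F = trans 1,0 (sym δ[2·y])
      twist₁ 3F = trans (i,2 1F) (trans (+-comm _ _) (trans (+-congˡ (×-homo-1 s)) (sym δ[3·y])))

      twist : ∀ j j′ → g (B₃.ε j *ₘ B₃.mod2 j′ , 2F *ₘ j *ₘ j′) ≈ toℕ j′ · δ (toℕ j · y)
      twist 0F 0F = 0,0
      twist 1F 0F = 0,0
      twist 2F 0F = 0,0
      twist 3F 0F = 0,0
      twist j  1F = trans (twist₁ j) (sym (×-homo-1 _))
      twist 0F 2F = trans 0,0 (sym (2·δ≈0 _))
      twist 1F 2F = trans 0,0 (sym (2·δ≈0 _))
      twist 2F 2F = trans 0,0 (sym (2·δ≈0 _))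
      twist 3F 2F = trans 0,0 (sym (2·δ≈0 _))
      twist 0F 3F = trans (twist₁ 0F) (sym (3·δ≈δ _))
      twist 1F 3F = trans (twist₁ 1F) (sym (3·δ≈δ _))
      twist 2F 3F = trans (twist₁ 2F) (sym (3·δ≈δ _))
      twist 3F 3F = trans (twist₁ 3F) (sym (3·δ≈δ _))

      iso : A ≅ B₃
      iso = ≅-fromHom A B₃ g (λ { ≡.refl → refl }) (λ (i , j) (i′ , j′) → g-+ i j i′ j′)
        (λ (i , j) (i′ , j′) → g-∘ ¬Fixed-y i j i′ j′ (B₃.ε j *ₘ B₃.mod2 j′) (2F *ₘ j *ₘ j′) (twist j j′))
        kernel surj
        where
        -- For nonzero `j`, applying `δ` removes the multiple of `s` and leaves `δ y`, `s` or
        -- `δ y + s`. None of these vanishes: `s` is nonzero, and a further `δ` sends the other two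
        -- to `s`.
        kernel : ∀ ij → g ij ≈ 0# → ij ≡ (0F , 0F)
        kernel (0F , 0F) _ = ≡.refl
        kernel (1F , 0F) ≈0 = contradiction (trans (sym 1,0) ≈0) s≉0
        kernel (i , 1F) ≈0 = contradiction δy≈0 δy≉0
          where
          δy≉0 : ¬ (δ y ≈ 0#)
          δy≉0 eq = s≉0 (trans (sym δδy≈s) (trans (δ-cong eq) δ0≈0))
          δy≈0 : δ y ≈ 0#
          δy≈0 = trans (sym δ[1·y]) (trans (sym (δ-g i 1F)) (trans (δ-cong ≈0) δ0≈0))
        kernel (i , 2F) ≈0 = contradiction
          (trans (sym δ[2·y]) (trans (sym (δ-g i 2F)) (trans (δ-cong ≈0) δ0≈0))) s≉0
        kernel (i , 3F) ≈0 = contradiction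
          (begin
            s                ≈⟨ δδy≈s ⟨
            δ (δ y)          ≈⟨ +-identityʳ _ ⟨
            δ (δ y) + 0#     ≈⟨ +-congˡ δs≈0 ⟨
            δ (δ y) + δ s    ≈⟨ δ-homo-+ (δ y) Fixed-s ⟨
            δ (δ y + s)      ≈⟨ δ-cong δ[3·y] ⟨
            δ (δ (3 · y))    ≈⟨ δ-cong (δ-g i 3F) ⟨
            δ (δ (g (i , 3F)))  ≈⟨ δ-cong (δ-cong ≈0) ⟩
            δ (δ 0#)         ≈⟨ δδ≈0 Fixed-0 ⟩
            0#               ∎) s≉0

        surj : ∀ z → ∃ λ ij → g ij ≈ z
        surj z with coset? ¬Fixed-y z
        ... | inj₁ Fz = case fixed Fz of λ where
          (i , inj₁ z≈) → (i , 0F) , trans (+-identityʳ _) (sym z≈)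
          (i , inj₂ z≈) → (i , 2F) , trans (i,2 i) (sym z≈)
        ... | inj₂ Fz-y = case fixed Fz-y of λ where
          (i , inj₁ ≈is) → (i , 1F) , (begin
            toℕ i · s + 1 · y    ≈⟨ +-cong (sym ≈is) (×-homo-1 y) ⟩
            z - y + y            ≈⟨ +.//-rightDividesˡ y z ⟩
            z                    ∎)
          (i , inj₂ ≈is+δy) → (i , 3F) , (begin
            toℕ i · s + 3 · y          ≈⟨ +-congˡ (trans 3·y≈ (+-comm y (δ y))) ⟩
            toℕ i · s + (δ y + y)      ≈⟨ +-assoc _ _ _ ⟨
            toℕ i · s + δ y + y        ≈⟨ +-congʳ ≈is+δy ⟨
            z - y + y                  ≈⟨ +.//-rightDividesˡ y z ⟩
            z                          ∎)

    -- Determination of the fixed points and choice of the generator.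

    Fixed-small : δ (δ x) ≈ 0# → ∀ {v} → Fixed v → v ≈ 0# ⊎ v ≈ s
    Fixed-small δδx≈0 {v} Fv = let a , δa≈v = δ-surjective Fv in
      δ-kernel (trans (δ-cong (sym δa≈v)) (δδ-vanishes a (coset? ¬Fixed-x a)))
      where
      -- The fixed points are the image of `δ`, so they lie in its kernel once `δ` composed with
      -- itself vanishes everywhere. On fixed elements this is `δδ≈0`; on the coset of `x` it
      -- reduces to the hypothesis on `x`.
      δδ-vanishes : ∀ a → Fixed a ⊎ Fixed (a - x) → δ (δ a) ≈ 0#
      δδ-vanishes a (inj₁ Fa) = δδ≈0 Fa
      δδ-vanishes a (inj₂ Fa-x) = begin
        δ (δ a)                        ≈⟨ δ-cong (δ-cong (y+[z-y]≈z x a)) ⟨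
        δ (δ (x + (a - x)))            ≈⟨ δ-cong (δ-homo-+ x Fa-x) ⟩
        δ (δ x + δ (a - x))            ≈⟨ δ-homo-+ (δ x) (Fixed-δ (a - x)) ⟩
        δ (δ x) + δ (δ (a - x))        ≈⟨ +-cong δδx≈0 (δδ≈0 Fa-x) ⟩
        0# + 0#                        ≈⟨ +-identityˡ 0# ⟩
        0#                             ∎

    -- If `δ x` vanished, `x` would itself be `0#` or `s`, both of which are fixed.
    δδx≈0⇒δx≈s : δ (δ x) ≈ 0# → δ x ≈ s
    δδx≈0⇒δx≈s δδx≈0 with δ-kernel δδx≈0
    ... | inj₂ δx≈s = δx≈s
    ... | inj₁ δx≈0 = case δ-kernel δx≈0 of λ where
      (inj₁ x≈0) → contradiction (Fixed-resp (sym x≈0) Fixed-0) ¬Fixed-x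
      (inj₂ x≈s) → contradiction (Fixed-resp (sym x≈s) Fixed-s) ¬Fixed-x

    -- Fixed points have exponent two, so `v + q` is the difference of `v` and `q`, and it lies in
    -- the kernel of `δ`.
    δ≈δ⇒Fixed≈ : ∀ {q v} → Fixed q → Fixed v → δ v ≈ δ q →
      ∃ λ (i : ℤ/ 2) → v ≈ toℕ i · s + q
    δ≈δ⇒Fixed≈ {q} {v} Fq Fv δv≈δq = case δ-kernel δ[v+q]≈0 of λ where
        (inj₁ ≈0) → 0F , trans v≈ (+-congʳ ≈0)
        (inj₂ ≈s) → 1F , trans v≈ (+-congʳ (trans ≈s (sym (×-homo-1 s))))
      where
      δ[v+q]≈0 : δ (v + q) ≈ 0#
      δ[v+q]≈0 = trans (δ-homo-+ v Fq) (trans (+-congʳ δv≈δq) (δ+δ≈0 q))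
      v≈ : v ≈ v + q + q
      v≈ = sym (trans (+-assoc v q q) (trans (+-congˡ (Fixed⇒+≈0 Fq)) (+-identityʳ v)))

    -- By `δδ≈0`, `δ v` is `0#` or `s`, that is, `δ 0#` or `δ (δ y)`; this determines `v` up to a
    -- multiple of `s`.
    Fixed-large : ∀ {y} → δ (δ y) ≈ s → ∀ {v} → Fixed v →
      ∃ λ (i : ℤ/ 2) → v ≈ toℕ i · s ⊎ v ≈ toℕ i · s + δ y
    Fixed-large {y} δδy≈s {v} Fv = case δ-kernel (δδ≈0 Fv) of λ where
      (inj₁ δv≈0) → let i , eq = δ≈δ⇒Fixed≈ Fixed-0 Fv (trans δv≈0 (sym δ0≈0)) in
        i , inj₁ (trans eq (+-identityʳ _))
      (inj₂ δv≈s) → let i , eq = δ≈δ⇒Fixed≈ (Fixed-δ y) Fv (trans δv≈s (sym δδy≈s)) in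
        i , inj₂ eq

    δδx≈s⇒≅B₃ : δ (δ x) ≈ s → A ≅ B₃
    -- `x + x` and `q` have the same image under `δ`, so they differ by a multiple of `s`.
    δδx≈s⇒≅B₃ δδx≈s = case δ≈δ⇒Fixed≈ (Fixed-δ x) Fixed-x+x δ[x+x]≈δδx of λ where
        (0F , x+x≈q) →
          Case₃.iso x ¬Fixed-x (trans x+x≈q (+-identityˡ q)) δδx≈s (Fixed-large δδx≈s)
        -- Here x + q is a generator as in the previous case: 2(x + q) = 2x = s + q = δ (x + q).
        (1F , x+x≈s+q) →
          Case₃.iso (x + q) (¬Fixed-+ ¬Fixed-x (Fixed-δ x))
            (begin
              x + q + (x + q)    ≈⟨ solve 2 (λ x q → (x ⊕ q) ⊕ (x ⊕ q) ⊜ (x ⊕ x) ⊕ (q ⊕ q)) refl x q ⟩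
              x + x + (q + q)    ≈⟨ +-cong x+x≈s+q (δ+δ≈0 x) ⟩
              1 · s + q + 0#     ≈⟨ +-identityʳ _ ⟩
              1 · s + q          ≈⟨ +-congʳ (×-homo-1 s) ⟩
              s + q              ≈⟨ +-comm s q ⟩
              q + s              ≈⟨ δ[x+q] ⟨
              δ (x + q)          ∎)
            δδ[x+q] (Fixed-large δδ[x+q])
      where
      q : Carrier
      q = δ x

      δ[x+x]≈δδx : δ (x + x) ≈ δ (δ x)
      δ[x+x]≈δδx = +.∙-cancelʳ (δ (δ x)) _ _ (trans δ[x+x]+δδx≈0 (sym (δ+δ≈0 (δ x))))

      δ[x+q] : δ (x + q) ≈ q + s
      δ[x+q] = trans (δ-homo-+ x (Fixed-δ x)) (+-congˡ δδx≈s)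

      δδ[x+q] : δ (δ (x + q)) ≈ s
      δδ[x+q] = begin
        δ (δ (x + q))    ≈⟨ δ-cong δ[x+q] ⟩
        δ (q + s)        ≈⟨ δ-homo-+ q Fixed-s ⟩
        δ q + δ s        ≈⟨ +-cong δδx≈s δs≈0 ⟩
        s + 0#           ≈⟨ +-identityʳ s ⟩
        s                ∎

    classification : (A ≅ B₁) ⊎ (A ≅ B₂) ⊎ (A ≅ B₃)
    -- As `δ x` is fixed, `δδ≈0` places `δ (δ x)` in the kernel of `δ`.
    classification with δ-kernel (δδ≈0 (Fixed-δ x))
    ... | inj₂ δδx≈s = inj₂ (inj₂ (δδx≈s⇒≅B₃ δδx≈s))
    ... | inj₁ δδx≈0 = case fixed Fixed-x+x of λ where
        (inj₁ x+x≈0) → inj₂ (inj₁ (Case₂.iso δx≈s fixed x+x≈0))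
        (inj₂ x+x≈s) → inj₁ (Case₁.iso δx≈s fixed x+x≈s)
      where
      δx≈s : δ x ≈ s
      δx≈s = δδx≈0⇒δx≈s δδx≈0
      fixed : ∀ {v} → Fixed v → v ≈ 0# ⊎ v ≈ s
      fixed = Fixed-small δδx≈0

mainTheorem20 : ∀ {c ℓ : Level} (A : SkewBrace c ℓ) (fin : Finite A)
    → AdditivelyAbelian A
    → HasExactlyOneVertex (Θ A fin)
    → (A ≅ B₁) ⊎ (A ≅ B₂) ⊎ (A ≅ B₃)
mainTheorem20 A fin +-comm one =
  let x , ¬Fixed-x , classify = uniqueOrbit one
      s , s≉e , λsx≈x = NonFixed.stabiliser-nontrivial x ¬Fixed-x
  in HalfFixed.classification x ¬Fixed-x classify
       (Packing.coset-x x ¬Fixed-x classify s s≉e λsx≈x) s s≉e λsx≈x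
       (Packing.stabiliser x ¬Fixed-x classify s s≉e λsx≈x)
  where open FiniteBrace A +-comm fin
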